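{- Let $n\ge 2$, let $G$ be a simple undirected graph with $n$ nodes, and let $\widehat{L}=(\widehat{l}_{ij})\in\mathbb{R}^{n\times n}$ be the Laplacian matrix of $G$ with respect to a numbering $1,\dots,n$ of its nodes given by the RCM (Reverse Cuthill-McKee) algorithm. For $i\in\{1,\dots,n\}$ put $s_i(\widehat{L})=\sum_{j=1}^{i}\widehat{l}_{ij}$. Suppose there exists $p\in\{1,\dots,n\}$ with $p<n$ such that $s_i(\widehat{L})\neq 0$ for $i=1,2,\dots,p-1$ and $s_p(\widehat{L})=0$. Then $\widehat{L}$ is a block diagonal matrix of the form $$\widehat{L}=\begin{bmatrix}\widehat{L}_{11} & 0\\ 0 & \widehat{L}_{22}\end{bmatrix}$$ with $\widehat{L}_{11}$ of size $p\times p$, where $\widehat{L}_{11}$ is irreducible if $p>1$ and is a zero matrix if $p=1$.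
   Context: Graphs are finite, undirected, without loops or multiple edges. For a graph with $n$ nodes numbered $1,\dots,n$ and adjacency matrix $A=(a_{ij})$, the (unnormalized) Laplacian matrix is $L=D-A$, where $D=\mathrm{diag}(d_1,\dots,d_n)$ and $d_i=\sum_{j}a_{ij}$ is the degree of node $i$. RCM ordering: build a list $u_1,u_2,\dots,u_n$ of all nodes as follows. Select a starting node (arbitrary, e.g. one of lowest degree) and let it be $u_1$. For $i=1,2,\dots$ in turn, append to the end of the list the neighbors of $u_i$ that are not yet in the list, in increasing order of degree (ties broken arbitrarily). If all listed nodes have been processed in this way but some nodes are not yet listed, select a new starting node among the unlisted ones, append it to the list, and continue. Finally reverse the order: node $u_j$ receives the new number $n+1-j$. If $P$ is the corresponding permutation matrix ($p_{ij}=1$ iff the node with new number $i$ has original number $j$), the Laplacian of the graph ordered by RCM is $\widehat{L}=PLP^T$. A matrix $M\in\mathbb{R}^{n\times n}$ with $n\ge 2$ is reducible if there are a permutation matrix $Q$ and an integer $1\le r\le n-1$ such that $Q^TMQ=\begin{bmatrix} B & C\\ 0 & E\end{bmatrix}$ with $B\in\mathbb{R}^{r\times r}$ and $0$ the $(n-r)\times r$ zero block; a $1\times 1$ matrix is reducible if it is $0$. A matrix is irreducible if it is not reducible. -}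

module Defs where

open import Data.Bool using (Bool; true; false; if_then_else_; T)
open import Data.Fin using (Fin; zero; toℕ; cast; inject≤; splitAt)
import Data.Fin as Fin
open import Data.Fin.Permutation using (Permutation′; _⟨$⟩ʳ_)
open import Data.Fin.Properties using (toℕ<n)
open import Data.Integer using (ℤ; 0ℤ; 1ℤ; _*_; _-_; _≤_)
open import Data.Integer.Properties using (+-0-commutativeMonoid)
open import Data.List using (List; []; _∷_; _++_; [_]; reverse; tabulate)
open import Data.List.Membership.Propositional using (_∈_; _∉_)
open import Data.List.Relation.Unary.Linked using (Linked)
open import Data.List.Relation.Unary.Unique.Propositional using (Unique)
open import Data.Nat using (ℕ; zero; suc; _∸_)
import Data.Nat as ℕ
open import Data.Nat.Properties using (m+[n∸m]≡n; <⇒≤)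
open import Data.Product using (Σ-syntax; ∃-syntax; _×_)
open import Data.Sum using (_⊎_; inj₁; inj₂)
open import Function.Bundles using (_⇔_)
open import Relation.Binary.PropositionalEquality using (_≡_; sym)
open import Relation.Nullary using (¬_; does)
open import Algebra.Properties.CommutativeMonoid.Sum +-0-commutativeMonoid using (sum)

-- Every matrix considered below (adjacency, permutation and Laplacian
-- matrices, and their blocks) is integral, so ℤ stands in for the real field.
Matrix : ℕ → ℕ → Set
Matrix m n = Fin m → Fin n → ℤ

infix 4 _≋_
_≋_ : ∀ {m n} → Matrix m n → Matrix m n → Set
M ≋ N = ∀ i j → M i j ≡ N i j

0ᴹ : ∀ {m n} → Matrix m n
0ᴹ _ _ = 0ℤ

infixl 7 _·_
_·_ : ∀ {l m n} → Matrix l m → Matrix m n → Matrix l n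
(M · N) i j = sum (λ k → M i k * N k j)

infix 8 _ᵀ
_ᵀ : ∀ {m n} → Matrix m n → Matrix n m
(M ᵀ) i j = M j i

permMatrix : ∀ {n} → Permutation′ n → Matrix n n
permMatrix π i j = if does (π ⟨$⟩ʳ i Fin.≟ j) then 1ℤ else 0ℤ

split : ∀ {n r} → r ℕ.≤ n → Fin n → Fin r ⊎ Fin (n ∸ r)
split {r = r} r≤n i = splitAt r (cast (sym (m+[n∸m]≡n r≤n)) i)

-- The n × n matrix  [ B C ; D E ]  whose leading block B is r × r.
blocks : ∀ {n r} → r ℕ.≤ n →
         Matrix r r → Matrix r (n ∸ r) →
         Matrix (n ∸ r) r → Matrix (n ∸ r) (n ∸ r) →
         Matrix n n
blocks r≤n B C D E i j with split r≤n i | split r≤n j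
... | inj₁ i′ | inj₁ j′ = B i′ j′
... | inj₁ i′ | inj₂ j′ = C i′ j′
... | inj₂ i′ | inj₁ j′ = D i′ j′
... | inj₂ i′ | inj₂ j′ = E i′ j′

Reducible : ∀ {m} → Matrix (suc m) (suc m) → Set
Reducible {zero}  M = M zero zero ≡ 0ℤ
Reducible {suc m} M =
  let n = suc (suc m) in
  Σ[ σ ∈ Permutation′ n ] Σ[ r ∈ ℕ ] 1 ℕ.≤ r × Σ[ r<n ∈ r ℕ.< n ]
  Σ[ B ∈ Matrix r r ] Σ[ C ∈ Matrix r (n ∸ r) ] Σ[ E ∈ Matrix (n ∸ r) (n ∸ r) ]
    permMatrix σ ᵀ · M · permMatrix σ ≋ blocks (<⇒≤ r<n) B C 0ᴹ E

Irreducible : ∀ {m} → Matrix (suc m) (suc m) → Set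
Irreducible M = ¬ Reducible M

-- The sum of the entries of row i up to and including the diagonal.
s : ∀ {n} → Matrix n n → Fin n → ℤ
s M i = sum {suc (toℕ i)} (λ j → M i (inject≤ j (toℕ<n i)))

record Graph (n : ℕ) : Set where
  field
    adj        : Fin n → Fin n → Bool
    adj-sym    : ∀ u v → adj u v ≡ adj v u
    adj-irrefl : ∀ u → adj u u ≡ false

module _ {n : ℕ} (G : Graph n) where
  open Graph G

  adjacency : Matrix n n
  adjacency i j = if adj i j then 1ℤ else 0ℤ

  degree : Fin n → ℤ
  degree i = sum (adjacency i)

  degreeMatrix : Matrix n n
  degreeMatrix i j = if does (i Fin.≟ j) then degree i else 0ℤ

  laplacian : Matrix n n
  laplacian i j = degreeMatrix i j - adjacency i j

  -- CMRun done queue: the (nondeterministic) Cuthill-McKee procedure can reach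
  -- the state in which the list of nodes is done ++ queue, where the nodes of
  -- done have been processed and those of queue have not.
  data CMRun : List (Fin n) → List (Fin n) → Set where
    begin   : CMRun [] []
    select  : ∀ {done} u → CMRun done [] → u ∉ done → CMRun done [ u ]
    process : ∀ {done queue} u ns → CMRun done (u ∷ queue) →
              Unique ns →
              (∀ v → v ∈ ns ⇔ (T (adj u v) × v ∉ done ++ u ∷ queue)) →
              Linked (λ v w → degree v ≤ degree w) ns →
              CMRun (done ++ [ u ]) (queue ++ ns)

  CMOrder : List (Fin n) → Set
  CMOrder us = CMRun us [] × (∀ v → v ∈ us)

  -- π sends each new number to the node that receives it.
  RCMNumbering : Permutation′ n → Set
  RCMNumbering π = ∃[ us ] CMOrder us × tabulate (π ⟨$⟩ʳ_) ≡ reverse us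

  renumberedLaplacian : Permutation′ n → Matrix n n
  renumberedLaplacian π = permMatrix π · laplacian · permMatrix π ᵀ

{-# OPTIONS --safe #-}

-- The rows of the Laplacian sum to zero and its off-diagonal entries are
-- nonpositive, so s_i vanishes iff node i has no neighbour with a larger
-- number, i.e. no neighbour preceding it in the Cuthill-McKee list.  Every node
-- u of that list either has a preceding neighbour, or was selected at a moment
-- when the nodes preceding it formed a union of components.  At the first zero
-- s_p the second case holds for p, so no edge joins {1,…,p} to {p+1,…,n}; and
-- each i < p has a neighbour j with i < j ≤ p, so {1,…,p} is connected through p.
module Submission where

import Data.Integer.Properties as ℤ
open import Algebra.Properties.AbelianGroup ℤ.+-0-abelianGroup using (∙-cancelˡ)
open import Algebra.Properties.CommutativeMonoid.Sum ℤ.+-0-commutativeMonoid using (sum; sum-remove; sum-cong-≗; sum-replicate-zero; sum-permute; ∑-distrib-+)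
open import Data.Bool using (Bool; true; false; if_then_else_; T)
import Data.Bool.Properties as Bool
open import Data.Fin using (Fin; zero; suc; toℕ; fromℕ; fromℕ<; cast; inject≤; punchIn; _↑ˡ_; _↑ʳ_)
import Data.Fin as Fin
open import Data.Fin.Induction using (>-wellFounded; Acc; acc)
open import Data.Fin.Permutation using (Permutation′; _⟨$⟩ʳ_; _⟨$⟩ˡ_; inverseˡ; inverseʳ)
open import Data.Fin.Properties using (toℕ<n; toℕ-injective; toℕ-cast; toℕ-inject≤; toℕ-↑ˡ; toℕ-↑ʳ; toℕ-fromℕ; toℕ-fromℕ<; splitAt⁻¹-↑ˡ; splitAt⁻¹-↑ʳ; punchInᵢ≢i; any?)
open import Data.Integer using (ℤ; 0ℤ; 1ℤ; -_; _+_; _*_; _-_)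
import Data.Integer as ℤ
open import Data.List using (List; []; _∷_; _++_; [_]; reverse; tabulate)
import Data.List.Membership.DecPropositional as DecMembership
open import Data.List.Membership.Propositional using (_∈_)
open import Data.List.Membership.Propositional.Properties using (∈-++⁺ˡ; ∈-++⁺ʳ; ∈-++⁻; ∈-tabulate⁺; ∈-tabulate⁻)
open import Data.List.Properties using (reverse-++; unfold-reverse; reverse-involutive; ++-assoc; ++-identityʳ; ∷-injective)
open import Data.List.Relation.Unary.Any using (here)
open import Data.List.Relation.Unary.Any.Properties using (reverse⁺; reverse⁻)
open import Data.Nat using (ℕ; zero; suc; _≤_; _<_; _>_; _∸_; z≤n; s≤s)
import Data.Nat as ℕ
import Data.Nat.Properties as ℕ
open import Data.Product using (Σ-syntax; ∃-syntax; _×_; _,_; proj₁; proj₂)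
open import Data.Sum using (_⊎_; inj₁; inj₂)
open import Function using (_∘_; Equivalence)
open import Relation.Binary.PropositionalEquality using (_≡_; _≢_; refl; sym; trans; cong; cong₂; subst; subst₂; module ≡-Reasoning)
open import Relation.Nullary using (¬_; yes; no; contradiction)
open import Relation.Nullary.Decidable using (_×-dec_; dec-true; dec-false)
open import Defs hiding (begin)

-- Sums

sum-zero : ∀ {n} {f : Fin n → ℤ} → (∀ i → f i ≡ 0ℤ) → sum f ≡ 0ℤ
sum-zero {n} f≡0 = trans (sum-cong-≗ f≡0) (sum-replicate-zero n)

sum-single : ∀ {n} (f : Fin n → ℤ) a → (∀ k → k ≢ a → f k ≡ 0ℤ) → sum f ≡ f a
sum-single {suc n} f a f≡0 = begin
  sum f                           ≡⟨ sum-remove {i = a} f ⟩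
  f a + sum (f ∘ punchIn a)       ≡⟨ cong (f a +_) (sum-zero (λ k → f≡0 _ (punchInᵢ≢i a k))) ⟩
  f a + 0ℤ                        ≡⟨ ℤ.+-identityʳ (f a) ⟩
  f a                             ∎
  where open ≡-Reasoning

sum-neg : ∀ {n} (f : Fin n → ℤ) → sum (λ i → - f i) ≡ - sum f
sum-neg {zero}  f = refl
sum-neg {suc n} f = trans (cong (- f zero +_) (sum-neg (f ∘ suc))) (sym (ℤ.neg-distrib-+ (f zero) _))

sum-nonpos : ∀ {n} {f : Fin n → ℤ} → (∀ i → f i ℤ.≤ 0ℤ) → sum f ℤ.≤ 0ℤ
sum-nonpos {zero}  f≤0 = ℤ.≤-refl
sum-nonpos {suc n} f≤0 = ℤ.+-mono-≤ (f≤0 zero) (sum-nonpos (f≤0 ∘ suc))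

nonpos-sum-zero : ∀ {n} (f : Fin n → ℤ) → (∀ i → f i ℤ.≤ 0ℤ) → sum f ≡ 0ℤ → ∀ i → f i ≡ 0ℤ
nonpos-sum-zero {suc n} f f≤0 ∑f≡0 i = ℤ.≤-antisym (f≤0 i) (begin
  0ℤ                         ≡⟨ ∑f≡0 ⟨
  sum f                      ≡⟨ sum-remove {i = i} f ⟩
  f i + sum (f ∘ punchIn i)  ≤⟨ ℤ.+-monoʳ-≤ (f i) (sum-nonpos (f≤0 ∘ punchIn i)) ⟩
  f i + 0ℤ                   ≡⟨ ℤ.+-identityʳ (f i) ⟩
  f i                        ∎)
  where open ℤ.≤-Reasoning

-- Used on row `i` with `k` equal to `suc (toℕ i)`: once the entries right of the diagonal vanish,
-- `s` is the full row sum.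
prefix-sum : ∀ {k n} (k≤n : k ≤ n) (f : Fin n → ℤ) → (∀ j → k ≤ toℕ j → f j ≡ 0ℤ) →
             sum {k} (λ j → f (inject≤ j k≤n)) ≡ sum f
prefix-sum z≤n       f f≡0 = sym (sum-zero (λ j → f≡0 j z≤n))
prefix-sum (s≤s k≤n) f f≡0 = cong (f zero +_) (prefix-sum k≤n (f ∘ suc) (λ j k≤j → f≡0 (suc j) (s≤s k≤j)))

-- Cancelling the first `k` terms leaves a tail of nonpositive terms with sum zero. No sign is asked
-- of the first `k` terms, because the diagonal entry of a Laplacian may be positive.
nonpos-suffix-zero : ∀ {k n} (k≤n : k ≤ n) (f : Fin n → ℤ) → (∀ j → k ≤ toℕ j → f j ℤ.≤ 0ℤ) →
                     sum {k} (λ j → f (inject≤ j k≤n)) ≡ sum f → ∀ j → k ≤ toℕ j → f j ≡ 0ℤ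
nonpos-suffix-zero z≤n f f≤0 eq j _ = nonpos-sum-zero f (λ i → f≤0 i z≤n) (sym eq) j
nonpos-suffix-zero (s≤s k≤n) f f≤0 eq (suc j) (s≤s k≤j) =
  nonpos-suffix-zero k≤n (f ∘ suc) (λ i k≤i → f≤0 (suc i) (s≤s k≤i))
    (∙-cancelˡ (f zero) _ _ eq) j k≤j

-- Permutation matrices

⟨$⟩ʳ-injective : ∀ {n} (π : Permutation′ n) {i j} → π ⟨$⟩ʳ i ≡ π ⟨$⟩ʳ j → i ≡ j
⟨$⟩ʳ-injective π eq = trans (sym (inverseˡ π)) (trans (cong (π ⟨$⟩ˡ_) eq) (inverseˡ π))

permMatrix-≡ : ∀ {n} (π : Permutation′ n) {i j} → π ⟨$⟩ʳ i ≡ j → permMatrix π i j ≡ 1ℤ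
permMatrix-≡ π {i} {j} eq = cong (if_then 1ℤ else 0ℤ) (dec-true (π ⟨$⟩ʳ i Fin.≟ j) eq)

permMatrix-≢ : ∀ {n} (π : Permutation′ n) {i j} → π ⟨$⟩ʳ i ≢ j → permMatrix π i j ≡ 0ℤ
permMatrix-≢ π {i} {j} neq = cong (if_then 1ℤ else 0ℤ) (dec-false (π ⟨$⟩ʳ i Fin.≟ j) neq)

-- In the uses below `e` is a row or a column of a permutation matrix.
sum-*-selectˡ : ∀ {n} (e f : Fin n → ℤ) a → e a ≡ 1ℤ → (∀ k → k ≢ a → e k ≡ 0ℤ) →
                sum (λ k → e k * f k) ≡ f a
sum-*-selectˡ e f a ea≡1 e≡0 = begin
  sum (λ k → e k * f k)  ≡⟨ sum-single _ a (λ k k≢a → trans (cong (_* f k) (e≡0 k k≢a)) (ℤ.*-zeroˡ (f k))) ⟩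
  e a * f a              ≡⟨ cong (_* f a) ea≡1 ⟩
  1ℤ * f a               ≡⟨ ℤ.*-identityˡ (f a) ⟩
  f a                    ∎
  where open ≡-Reasoning

sum-*-selectʳ : ∀ {n} (e f : Fin n → ℤ) a → e a ≡ 1ℤ → (∀ k → k ≢ a → e k ≡ 0ℤ) →
                sum (λ k → f k * e k) ≡ f a
sum-*-selectʳ e f a ea≡1 e≡0 =
  trans (sum-cong-≗ (λ k → ℤ.*-comm (f k) (e k))) (sum-*-selectˡ e f a ea≡1 e≡0)

conjugate : ∀ {n} (π : Permutation′ n) (M : Matrix n n) i j →
            (permMatrix π · M · permMatrix π ᵀ) i j ≡ M (π ⟨$⟩ʳ i) (π ⟨$⟩ʳ j)
conjugate π M i j = trans
  (sum-*-selectʳ (permMatrix π j) ((permMatrix π · M) i) (π ⟨$⟩ʳ j) (permMatrix-≡ π refl) (λ _ k≢ → permMatrix-≢ π (k≢ ∘ sym)))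
  (sum-*-selectˡ (permMatrix π i) (λ k → M k (π ⟨$⟩ʳ j)) (π ⟨$⟩ʳ i) (permMatrix-≡ π refl) (λ _ k≢ → permMatrix-≢ π (k≢ ∘ sym)))

-- Evaluating at images under `σ` keeps the inverse permutation out of the formula: column
-- `σ ⟨$⟩ʳ j` of `permMatrix σ` has its only 1 in row `j`.
conjugateᵀ : ∀ {n} (σ : Permutation′ n) (M : Matrix n n) i j →
             (permMatrix σ ᵀ · M · permMatrix σ) (σ ⟨$⟩ʳ i) (σ ⟨$⟩ʳ j) ≡ M i j
conjugateᵀ σ M i j = trans
  (sum-*-selectʳ (λ k → permMatrix σ k (σ ⟨$⟩ʳ j)) ((permMatrix σ ᵀ · M) (σ ⟨$⟩ʳ i)) j (permMatrix-≡ σ refl) (off j))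
  (sum-*-selectˡ (λ k → permMatrix σ k (σ ⟨$⟩ʳ i)) (λ k → M k j) i (permMatrix-≡ σ refl) (off i))
  where
  off : ∀ j k → k ≢ j → permMatrix σ k (σ ⟨$⟩ʳ j) ≡ 0ℤ
  off j k k≢j = permMatrix-≢ σ (k≢j ∘ ⟨$⟩ʳ-injective σ)

-- Block matrices

module _ {n r} (r≤n : r ≤ n) where

  join₁ : Fin r → Fin n
  join₁ i = inject≤ i r≤n

  join₂ : Fin (n ∸ r) → Fin n
  join₂ i = cast (ℕ.m+[n∸m]≡n r≤n) (r ↑ʳ i)

  split-inj₁ : ∀ i {i′} → split r≤n i ≡ inj₁ i′ → toℕ i ≡ toℕ i′
  split-inj₁ i {i′} eq = begin
    toℕ i               ≡⟨ toℕ-cast (sym (ℕ.m+[n∸m]≡n r≤n)) i ⟨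
    toℕ (cast _ i)      ≡⟨ cong toℕ (splitAt⁻¹-↑ˡ {r} eq) ⟨
    toℕ (i′ ↑ˡ (n ∸ r)) ≡⟨ toℕ-↑ˡ i′ (n ∸ r) ⟩
    toℕ i′              ∎
    where open ≡-Reasoning

  split-inj₂ : ∀ i {i′} → split r≤n i ≡ inj₂ i′ → toℕ i ≡ r ℕ.+ toℕ i′
  split-inj₂ i {i′} eq = begin
    toℕ i               ≡⟨ toℕ-cast (sym (ℕ.m+[n∸m]≡n r≤n)) i ⟨
    toℕ (cast _ i)      ≡⟨ cong toℕ (splitAt⁻¹-↑ʳ {r} eq) ⟨
    toℕ (r ↑ʳ i′)       ≡⟨ toℕ-↑ʳ r i′ ⟩
    r ℕ.+ toℕ i′ ∎
    where open ≡-Reasoning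

  split-inj₁-< : ∀ i {i′} → split r≤n i ≡ inj₁ i′ → toℕ i < r
  split-inj₁-< i {i′} eq = subst (_< r) (sym (split-inj₁ i eq)) (toℕ<n i′)

  split-inj₂-≥ : ∀ i {i′} → split r≤n i ≡ inj₂ i′ → r ≤ toℕ i
  split-inj₂-≥ i {i′} eq = subst (r ≤_) (sym (split-inj₂ i eq)) (ℕ.m≤m+n r (toℕ i′))

  split-join₁ : ∀ i {i′} → split r≤n i ≡ inj₁ i′ → i ≡ join₁ i′
  split-join₁ i {i′} eq = toℕ-injective (trans (split-inj₁ i eq) (sym (toℕ-inject≤ i′ r≤n)))

  split-join₂ : ∀ i {i′} → split r≤n i ≡ inj₂ i′ → i ≡ join₂ i′
  split-join₂ i {i′} eq = toℕ-injective (trans (split-inj₂ i eq)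
    (sym (trans (toℕ-cast (ℕ.m+[n∸m]≡n r≤n) (r ↑ʳ i′)) (toℕ-↑ʳ r i′))))

  -- The only property of a block triangular form that the irreducibility argument uses.
  lowerLeft-zero : ∀ B C E {i j} → r ≤ toℕ i → toℕ j < r → blocks r≤n B C 0ᴹ E i j ≡ 0ℤ
  lowerLeft-zero B C E {i} {j} r≤i j<r with split r≤n i in eqᵢ | split r≤n j in eqⱼ
  ... | inj₁ _ | _      = contradiction r≤i (ℕ.<⇒≱ (split-inj₁-< i eqᵢ))
  ... | inj₂ _ | inj₁ _ = refl
  ... | inj₂ _ | inj₂ _ = contradiction (split-inj₂-≥ j eqⱼ) (ℕ.<⇒≱ j<r)

  block-diagonal : (M : Matrix n n) →
                   (∀ i j → toℕ i < r → r ≤ toℕ j → M i j ≡ 0ℤ × M j i ≡ 0ℤ) →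
                   M ≋ blocks r≤n (λ i j → M (join₁ i) (join₁ j)) 0ᴹ 0ᴹ (λ i j → M (join₂ i) (join₂ j))
  block-diagonal M off i j with split r≤n i in eqᵢ | split r≤n j in eqⱼ
  ... | inj₁ _ | inj₁ _ = cong₂ M (split-join₁ i eqᵢ) (split-join₁ j eqⱼ)
  ... | inj₁ _ | inj₂ _ = proj₁ (off i j (split-inj₁-< i eqᵢ) (split-inj₂-≥ j eqⱼ))
  ... | inj₂ _ | inj₁ _ = proj₂ (off j i (split-inj₁-< j eqⱼ) (split-inj₂-≥ i eqᵢ))
  ... | inj₂ _ | inj₂ _ = cong₂ M (split-join₂ i eqᵢ) (split-join₂ j eqⱼ)

-- Every index is joined to the last one by an increasing path of nonzero
-- entries, along which membership of the block [0,r) cannot change.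
irreducible : ∀ {m} → 1 < suc m → (M : Matrix (suc m) (suc m)) →
              (∀ i → toℕ i < m → ∃[ j ] i Fin.< j × M i j ≢ 0ℤ × M j i ≢ 0ℤ) →
              Irreducible M
-- In size 1 reducibility means being zero, a separate clause that the size bound rules out.
irreducible {zero}  (s≤s ()) M up
irreducible {suc m} _ M up (σ , r , 1≤r , r<n , B , C , E , eq) =
  contradiction r≤last (ℕ.<⇒≱ last<r)
  where
  n = suc (suc m)
  last = fromℕ (suc m)

  zero-entry : ∀ {i j} → r ≤ toℕ (σ ⟨$⟩ʳ i) → toℕ (σ ⟨$⟩ʳ j) < r → M i j ≡ 0ℤ
  zero-entry {i} {j} r≤i j<r = begin
    M i j                                                           ≡⟨ conjugateᵀ σ M i j ⟨
    (permMatrix σ ᵀ · M · permMatrix σ) (σ ⟨$⟩ʳ i) (σ ⟨$⟩ʳ j)       ≡⟨ eq _ _ ⟩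
    blocks (ℕ.<⇒≤ r<n) B C 0ᴹ E (σ ⟨$⟩ʳ i) (σ ⟨$⟩ʳ j)               ≡⟨ lowerLeft-zero (ℕ.<⇒≤ r<n) B C E r≤i j<r ⟩
    0ℤ                                                              ∎
    where open ≡-Reasoning

  SameSide : Fin n → Fin n → Set
  SameSide i j = (r ≤ toℕ (σ ⟨$⟩ʳ i) → r ≤ toℕ (σ ⟨$⟩ʳ j)) × (toℕ (σ ⟨$⟩ʳ i) < r → toℕ (σ ⟨$⟩ʳ j) < r)

  -- Only the lower left block is known to vanish, so each of the two entries forbids one direction
  -- of crossing.
  step : ∀ {i j} → M i j ≢ 0ℤ → M j i ≢ 0ℤ → SameSide i j
  step Mij≢0 Mji≢0 =
    (λ r≤i → ℕ.≮⇒≥ (λ j<r → Mij≢0 (zero-entry r≤i j<r))) ,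
    (λ i<r → ℕ.≰⇒> (λ r≤j → Mji≢0 (zero-entry r≤j i<r)))

  climb : ∀ i → Acc Fin._>_ i → SameSide i last
  climb i (acc rec) with toℕ i ℕ.<? suc m
  ... | no i≮m = subst (SameSide i)
        (toℕ-injective (trans (ℕ.≤-antisym (ℕ.s≤s⁻¹ (toℕ<n i)) (ℕ.≮⇒≥ i≮m)) (sym (toℕ-fromℕ (suc m)))))
        ((λ h → h) , (λ h → h))
  ... | yes i<m with up i i<m
  ... | j , i<j , Mij≢0 , Mji≢0 =
        let s₁ , s₂ = step Mij≢0 Mji≢0 ; t₁ , t₂ = climb j (rec i<j) in t₁ ∘ s₁ , t₂ ∘ s₂

  -- The index that `σ` sends to the last position lies beyond `r` and the one sent to position zero
  -- lies below it. Both climb to `last`, which would then be on both sides.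
  r≤last : r ≤ toℕ (σ ⟨$⟩ʳ last)
  r≤last = proj₁ (climb (σ ⟨$⟩ˡ last) (>-wellFounded _))
    (subst (r ≤_) (sym (trans (cong toℕ (inverseʳ σ {last})) (toℕ-fromℕ (suc m)))) (ℕ.s≤s⁻¹ r<n))

  last<r : toℕ (σ ⟨$⟩ʳ last) < r
  last<r = proj₂ (climb (σ ⟨$⟩ˡ zero) (>-wellFounded _))
    (subst (_< r) (sym (cong toℕ (inverseʳ σ {zero}))) 1≤r)

-- Lists

-- Decides whether a marked node `v` belongs to the older part of a Cuthill-McKee list or to the
-- part just appended.
++-∷-cases : ∀ {A : Set} (as : List A) {bs xs v ys} → as ++ bs ≡ xs ++ v ∷ ys →
             (∃[ ys′ ] as ≡ xs ++ v ∷ ys′) ⊎ (∃[ cs ] xs ≡ as ++ cs × bs ≡ cs ++ v ∷ ys)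
++-∷-cases []       {xs = xs}     eq = inj₂ (xs , refl , eq)
++-∷-cases (a ∷ as) {xs = []}     eq with refl , _ ← ∷-injective eq = inj₁ (as , refl)
++-∷-cases (a ∷ as) {xs = x ∷ xs} eq with refl , eq′ ← ∷-injective eq with ++-∷-cases as eq′
... | inj₁ (ys′ , refl)       = inj₁ (ys′ , refl)
... | inj₂ (cs , refl , refl) = inj₂ (cs , refl , refl)

reverse-++-∷ : ∀ {A : Set} (as : List A) {x} bs →
               reverse (as ++ x ∷ bs) ≡ reverse bs ++ x ∷ reverse as
reverse-++-∷ as {x} bs = begin
  reverse (as ++ x ∷ bs)              ≡⟨ reverse-++ as (x ∷ bs) ⟩
  reverse (x ∷ bs) ++ reverse as      ≡⟨ cong (_++ reverse as) (unfold-reverse x bs) ⟩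
  (reverse bs ++ [ x ]) ++ reverse as ≡⟨ ++-assoc (reverse bs) [ x ] (reverse as) ⟩
  reverse bs ++ x ∷ reverse as        ∎
  where open ≡-Reasoning

-- A `process` step moves the head of the queue to the processed nodes, so the whole list changes
-- only by what is appended.
++-shift-head : ∀ {A : Set} (as : List A) {x} bs cs →
                (as ++ x ∷ bs) ++ cs ≡ (as ++ [ x ]) ++ bs ++ cs
++-shift-head as {x} bs cs = trans (++-assoc as (x ∷ bs) cs) (sym (++-assoc as [ x ] (bs ++ cs)))

-- Reversing `bs` gives the nodes that precede `f p` in the Cuthill-McKee list.
tabulate-split : ∀ {A : Set} {n} (f : Fin n → A) p →
  ∃[ as ] ∃[ bs ] tabulate f ≡ as ++ f p ∷ bs
    × (∀ {j} → p Fin.< j → f j ∈ bs) × (∀ {x} → x ∈ bs → ∃[ j ] p Fin.< j × x ≡ f j)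
tabulate-split f zero = [] , tabulate (f ∘ suc) , refl ,
  (λ { {suc j} _ → ∈-tabulate⁺ j }) ,
  (λ x∈ → let j , x≡ = ∈-tabulate⁻ x∈ in suc j , s≤s z≤n , x≡)
tabulate-split f (suc p) with as , bs , eq , after , before ← tabulate-split (f ∘ suc) p =
  f zero ∷ as , bs , cong (f zero ∷_) eq ,
  (λ { {suc j} (s≤s p<j) → after p<j }) ,
  (λ x∈ → let j , p<j , x≡ = before x∈ in suc j , s≤s p<j , x≡)

module _ {n} (G : Graph n) where
  open Graph G

  -- The Cuthill-McKee procedure

  -- Invariant of the procedure. With an empty queue it says that the listed nodes form a union of
  -- components.
  done-closed : ∀ {done queue} → CMRun G done queue →
                ∀ {u w} → u ∈ done → T (adj u w) → w ∈ done ++ queue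
  done-closed (select u run _) x∈ e = ∈-++⁺ˡ (subst (_ ∈_) (++-identityʳ _) (done-closed run x∈ e))
  done-closed (process {done} {queue} u ns run _ ns⇔ _) {w = w} x∈ e =
    subst (w ∈_) (++-shift-head done queue ns) listed
    where
    listed : w ∈ (done ++ u ∷ queue) ++ ns
    listed with ∈-++⁻ done x∈
    ... | inj₁ x∈done = ∈-++⁺ˡ (done-closed run x∈done e)
    -- Only `u` is newly processed; a neighbour of it not listed before is among the appended `ns`.
    ... | inj₂ (here refl) with DecMembership._∈?_ Fin._≟_ w (done ++ u ∷ queue)
    ...   | yes w∈ = ∈-++⁺ˡ w∈
    ...   | no  w∉ = ∈-++⁺ʳ (done ++ u ∷ queue) (Equivalence.from (ns⇔ w) (e , w∉))

  -- As adjacency is symmetric, such a list is a union of connected components.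
  Closed : List (Fin n) → Set
  Closed xs = ∀ {x w} → x ∈ xs → T (adj x w) → w ∈ xs

  -- Quantifying over all splittings of the list lets induction on the run carry over the nodes
  -- listed earlier; only the nodes appended by the latest step need an argument.
  parent-or-start : ∀ {done queue} → CMRun G done queue → ∀ xs {v ys} →
                    done ++ queue ≡ xs ++ v ∷ ys →
                    (∃[ x ] x ∈ xs × T (adj x v)) ⊎ Closed xs
  parent-or-start CMRun.begin []      ()
  parent-or-start CMRun.begin (_ ∷ _) ()
  parent-or-start (select {done} u run _) xs eq with ++-∷-cases done eq
  ... | inj₁ (ys′ , eq′) = parent-or-start run xs (trans (++-identityʳ done) eq′)
  -- Here `v` is the selected node and `xs` is all that was listed before; the queue was empty, so
  -- `done-closed` applies.
  ... | inj₂ ([] , refl , _) = inj₂ (λ {x} {w} x∈ e →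
    subst (w ∈_) (sym (++-identityʳ _))
      (subst (w ∈_) (++-identityʳ _) (done-closed run (subst (x ∈_) (++-identityʳ _) x∈) e)))
  ... | inj₂ (c ∷ []    , _ , ())
  ... | inj₂ (c ∷ _ ∷ _ , _ , ())
  parent-or-start (process {done} {queue} u ns run _ ns⇔ _) xs {v} {ys} eq
    with ++-∷-cases (done ++ u ∷ queue) (trans (++-shift-head done queue ns) eq)
  ... | inj₁ (ys′ , eq′) = parent-or-start run xs eq′
  -- Here `v` lies in `ns`, and its parent is the node `u` being processed.
  ... | inj₂ (cs , refl , refl) = inj₁ (u , ∈-++⁺ˡ (∈-++⁺ʳ done (here refl)) ,
    proj₁ (Equivalence.to (ns⇔ v) (∈-++⁺ʳ cs (here refl))))

  -- The reversal turns "earlier in the Cuthill-McKee list" into "larger new number", so the prefix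
  -- before node `p` consists of the numbers above `p`.
  rcm-parent-or-start : ∀ π → RCMNumbering G π → ∀ p →
    (∃[ j ] p Fin.< j × T (adj (π ⟨$⟩ʳ j) (π ⟨$⟩ʳ p))) ⊎
    (∀ {i j} → p Fin.< j → T (adj (π ⟨$⟩ʳ j) (π ⟨$⟩ʳ i)) → p Fin.< i)
  rcm-parent-or-start π (us , (run , _) , eq) p
    with as , bs , split≡ , after , before ← tabulate-split (π ⟨$⟩ʳ_) p
    with parent-or-start run (reverse bs) (trans (++-identityʳ us) (trans (sym (reverse-involutive us))
           (trans (cong reverse (trans (sym eq) split≡)) (reverse-++-∷ as bs))))
  ... | inj₁ (x , x∈ , e) =
    let j , p<j , x≡πj = before (reverse⁻ x∈) in inj₁ (j , p<j , subst (λ y → T (adj y (π ⟨$⟩ʳ p))) x≡πj e)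
  ... | inj₂ closed =
    inj₂ (λ p<j e → let k , p<k , πi≡πk = before (reverse⁻ (closed (reverse⁺ (after p<j)) e))
                    in subst (p Fin.<_) (sym (⟨$⟩ʳ-injective π πi≡πk)) p<k)

  -- The Laplacian

  laplacian-≢ : ∀ {u v} → u ≢ v → laplacian G u v ≡ - adjacency G u v
  laplacian-≢ {u} {v} u≢v = trans
    (cong (λ b → (if b then degree G u else 0ℤ) - adjacency G u v) (dec-false (u Fin.≟ v) u≢v))
    (ℤ.+-identityˡ _)

  laplacian-adj : ∀ {u v} → u ≢ v → T (adj u v) → laplacian G u v ≢ 0ℤ
  laplacian-adj {u} {v} u≢v e Luv≡0 with adj u v | laplacian-≢ u≢v
  ... | true | Luv≡-1 = contradiction (trans (sym Luv≡0) Luv≡-1) λ ()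

  laplacian-¬adj : ∀ {u v} → u ≢ v → ¬ T (adj u v) → laplacian G u v ≡ 0ℤ
  laplacian-¬adj {u} {v} u≢v ¬e with adj u v | laplacian-≢ u≢v
  ... | true  | _     = contradiction _ ¬e
  ... | false | Luv≡0 = Luv≡0

  laplacian-nonpos : ∀ {u v} → u ≢ v → laplacian G u v ℤ.≤ 0ℤ
  laplacian-nonpos {u} {v} u≢v with adj u v | laplacian-≢ u≢v
  ... | true  | eq = subst (ℤ._≤ 0ℤ) (sym eq) ℤ.-≤+
  ... | false | eq = ℤ.≤-reflexive eq

  laplacian-row-sum : ∀ u → sum (laplacian G u) ≡ 0ℤ
  laplacian-row-sum u = begin
    sum (laplacian G u)                                        ≡⟨ ∑-distrib-+ (degreeMatrix G u) _ ⟩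
    sum (degreeMatrix G u) + sum (λ v → - adjacency G u v)     ≡⟨ cong₂ _+_ diagonal (sum-neg (adjacency G u)) ⟩
    degree G u - degree G u                                    ≡⟨ ℤ.+-inverseʳ (degree G u) ⟩
    0ℤ                                                         ∎
    where
    open ≡-Reasoning
    entry : Bool → ℤ
    entry b = if b then degree G u else 0ℤ
    diagonal : sum (degreeMatrix G u) ≡ degree G u
    diagonal = trans
      (sum-single (degreeMatrix G u) u (λ v v≢u → cong entry (dec-false (u Fin.≟ v) (v≢u ∘ sym))))
      (cong entry (dec-true (u Fin.≟ u) refl))

  -- The renumbered Laplacian and its partial row sums

  module _ (π : Permutation′ n) where

    adjπ : Fin n → Fin n → Set
    adjπ i j = T (adj (π ⟨$⟩ʳ i) (π ⟨$⟩ʳ j))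

    adjπ-sym : ∀ {i j} → adjπ i j → adjπ j i
    adjπ-sym = subst T (adj-sym _ _)

    private
      L̂ : Matrix n n
      L̂ = renumberedLaplacian G π

      L̂-entry : ∀ i j → L̂ i j ≡ laplacian G (π ⟨$⟩ʳ i) (π ⟨$⟩ʳ j)
      L̂-entry = conjugate π (laplacian G)

      π-≢ : ∀ {i j} → i ≢ j → π ⟨$⟩ʳ i ≢ π ⟨$⟩ʳ j
      π-≢ i≢j = i≢j ∘ ⟨$⟩ʳ-injective π

    renumbered-adj : ∀ {i j} → i ≢ j → adjπ i j → L̂ i j ≢ 0ℤ
    renumbered-adj i≢j e L̂≡0 = laplacian-adj (π-≢ i≢j) e (trans (sym (L̂-entry _ _)) L̂≡0)

    renumbered-¬adj : ∀ {i j} → i ≢ j → ¬ adjπ i j → L̂ i j ≡ 0ℤ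
    renumbered-¬adj i≢j ¬e = trans (L̂-entry _ _) (laplacian-¬adj (π-≢ i≢j) ¬e)

    renumbered-row-sum : ∀ i → sum (L̂ i) ≡ 0ℤ
    renumbered-row-sum i = begin
      sum (L̂ i)                                               ≡⟨ sum-cong-≗ (L̂-entry i) ⟩
      sum (λ j → laplacian G (π ⟨$⟩ʳ i) (π ⟨$⟩ʳ j))           ≡⟨ sum-permute (laplacian G (π ⟨$⟩ʳ i)) π ⟨
      sum (laplacian G (π ⟨$⟩ʳ i))                            ≡⟨ laplacian-row-sum (π ⟨$⟩ʳ i) ⟩
      0ℤ                                                      ∎
      where open ≡-Reasoning

    -- The partial sum agrees with the full row sum, zero, so the nonpositive entries right of the
    -- diagonal all vanish.
    s≡0⇒no-later-neighbour : ∀ {i} → s L̂ i ≡ 0ℤ → ∀ {j} → i Fin.< j → ¬ adjπ i j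
    s≡0⇒no-later-neighbour {i} s≡0 {j} i<j e = renumbered-adj (ℕ.<⇒≢ i<j ∘ cong toℕ) e
      (nonpos-suffix-zero (toℕ<n i) (L̂ i)
        (λ k i<k → subst (ℤ._≤ 0ℤ) (sym (L̂-entry i k)) (laplacian-nonpos (π-≢ (ℕ.<⇒≢ i<k ∘ cong toℕ))))
        (trans s≡0 (sym (renumbered-row-sum i))) j i<j)

    -- Without a later neighbour the partial sum would be the whole row sum, zero. The finite search
    -- makes the witness constructive.
    s≢0⇒later-neighbour : ∀ {i} → s L̂ i ≢ 0ℤ → ∃[ j ] i Fin.< j × adjπ i j
    s≢0⇒later-neighbour {i} s≢0
      with any? (λ j → i Fin.<? j ×-dec Bool.T? (adj (π ⟨$⟩ʳ i) (π ⟨$⟩ʳ j)))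
    ... | yes neighbour = neighbour
    ... | no  none = contradiction
      (trans (prefix-sum (toℕ<n i) (L̂ i)
        (λ k i<k → renumbered-¬adj (ℕ.<⇒≢ i<k ∘ cong toℕ) (λ e → none (k , i<k , e))))
        (renumbered-row-sum i)) s≢0

-- The block form

leading-block-zero : ∀ {n} (M : Matrix n n) p → s M p ≡ 0ℤ → suc (toℕ p) ≡ 1 →
                     (λ i j → M (join₁ (toℕ<n p) i) (join₁ (toℕ<n p) j)) ≋ 0ᴹ
leading-block-zero M zero s≡0 _ zero zero = trans (sym (ℤ.+-identityʳ _)) s≡0

theorem4p4 : (n : ℕ) → 2 ≤ n → (G : Graph n) (π : Permutation′ n) → RCMNumbering G π →
    let L̂ = renumberedLaplacian G π in
    (p : Fin n) → suc (toℕ p) < n →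
    (∀ i → i Fin.< p → s L̂ i ≢ 0ℤ) → s L̂ p ≡ 0ℤ →
    let k = suc (toℕ p) in
    Σ[ L₁₁ ∈ Matrix k k ] Σ[ L₂₂ ∈ Matrix (n ∸ k) (n ∸ k) ]
    (L̂ ≋ blocks (toℕ<n p) L₁₁ 0ᴹ 0ᴹ L₂₂)
    × (k > 1 → Irreducible L₁₁)
    × (k ≡ 1 → L₁₁ ≋ 0ᴹ)
theorem4p4 n _ G π rcm p _ s≢0 sp≡0 =
  -- Both diagonal blocks are inferred from `block-diagonal` as restrictions of `L̂`.
  _ , _ , block-diagonal k≤n L̂ off , (λ 1<k → irreducible 1<k _ up) , leading-block-zero L̂ p sp≡0
  where
  L̂ = renumberedLaplacian G π
  k≤n = toℕ<n p

  closed : ∀ {i j} → p Fin.< j → adjπ G π j i → p Fin.< i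
  -- A parent of `p` would be a later neighbour, excluded by `sp≡0`; hence the numbers above `p`
  -- form a union of components.
  closed with rcm-parent-or-start G π rcm p
  ... | inj₁ (j , p<j , e) = contradiction (adjπ-sym G π e) (s≡0⇒no-later-neighbour G π sp≡0 p<j)
  ... | inj₂ h = h

  off : ∀ i j → toℕ i < suc (toℕ p) → p Fin.< j → L̂ i j ≡ 0ℤ × L̂ j i ≡ 0ℤ
  off i j i≤p p<j =
    renumbered-¬adj G π i≢j (¬e ∘ adjπ-sym G π) , renumbered-¬adj G π (i≢j ∘ sym) ¬e
    where
    i≢j : i ≢ j
    i≢j refl = ℕ.<⇒≱ p<j (ℕ.s≤s⁻¹ i≤p)
    ¬e : ¬ adjπ G π j i
    ¬e e = ℕ.<⇒≱ (closed p<j e) (ℕ.s≤s⁻¹ i≤p)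

  -- The last index of the leading block is `p` itself, so every other index has a nonzero partial
  -- sum.
  up : ∀ i → toℕ i < toℕ p → ∃[ j ] i Fin.< j
       × L̂ (inject≤ i k≤n) (inject≤ j k≤n) ≢ 0ℤ × L̂ (inject≤ j k≤n) (inject≤ i k≤n) ≢ 0ℤ
  up i i<p with s≢0⇒later-neighbour G π (s≢0 (inject≤ i k≤n) (subst (_< toℕ p) (sym (toℕ-inject≤ i k≤n)) i<p))
  ... | j , i<j , e = j′ , i<j′ ,
        subst (λ l → L̂ i′ l ≢ 0ℤ) j≡ (renumbered-adj G π i≢j e) ,
        subst (λ l → L̂ l i′ ≢ 0ℤ) j≡ (renumbered-adj G π (i≢j ∘ sym) (adjπ-sym G π e))
    where
    i′ = inject≤ i k≤n
    i≢j : i′ ≢ j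
    i≢j = ℕ.<⇒≢ i<j ∘ cong toℕ
    -- The later neighbour stays inside the block: an edge from beyond `p` cannot reach `i`.
    j≤p : toℕ j < suc (toℕ p)
    j≤p = ℕ.≰⇒> λ p<j → ℕ.<⇒≱ (closed p<j (adjπ-sym G π e)) (subst (_≤ toℕ p) (sym (toℕ-inject≤ i k≤n)) (ℕ.<⇒≤ i<p))
    j′ = fromℕ< j≤p
    j≡ : j ≡ inject≤ j′ k≤n
    j≡ = toℕ-injective (sym (trans (toℕ-inject≤ j′ k≤n) (toℕ-fromℕ< j≤p)))
    i<j′ : i Fin.< j′
    i<j′ = subst₂ _<_ (toℕ-inject≤ i k≤n) (sym (toℕ-fromℕ< j≤p)) i<j
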